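{- For every integer $k \geq 1$ there is a graph $G$ of tree-width $k$ with $\operatorname{pn}_u(G) \geq \operatorname{pn}_\ell(G) \geq k$.
   Context: All graphs are finite and simple. A linear embedding of a graph $G=(V,E)$ is a pair $(\prec,\mathcal{P})$ where $\prec$ is a total order on $V$ and $\mathcal{P}$ is a partition of $E$ into parts called pages. Two edges $uv, xy$ with $u\prec v$, $x \prec y$ cross if $u \prec x \prec v \prec y$ or $x \prec u \prec y \prec v$. A linear embedding is a book embedding if no two crossing edges lie in the same page. For a book embedding and a vertex $v$, let $\mathcal{P}_v$ be the set of pages containing at least one edge incident to $v$; the embedding is $k$-local if $|\mathcal{P}_v|\le k$ for all $v$, and the local page number $\operatorname{pn}_\ell(G)$ is the least $k$ such that $G$ has a $k$-local book embedding (with any number of pages). For a page $P$, let $G_P$ be the subgraph consisting of the edges of $P$ and all vertices incident to an edge of $P$. A linear embedding is a union embedding if for every page $P$ and every connected component $C$ of $G_P$, no two edges of $C$ cross. The union page number $\operatorname{pn}_u(G)$ is the minimum number of pages in a union embedding of $G$. -}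

module Defs where

open import Data.Nat using (ℕ; zero; suc; _+_; _≤_; _<_; _⊓_; _⊔_)
open import Data.Fin using (Fin; toℕ; inject₁; fromℕ) renaming (zero to fzero; suc to fsuc)
open import Data.Bool using (Bool; true; false; if_then_else_)
open import Data.List using (List; length; map; allFin)
open import Data.Nat.ListAction using (sum)
open import Data.List.Membership.Propositional using (_∈_)
open import Data.Product using (Σ; ∃; _×_; _,_)
open import Data.Sum using (_⊎_)
open import Relation.Nullary using (¬_)
open import Relation.Binary.PropositionalEquality using (_≡_)
open import Function.Definitions using (Injective)

record Graph (n : ℕ) : Set where
  field
    adj    : Fin n → Fin n → Bool
    sym    : ∀ u v → adj u v ≡ adj v u
    irrefl : ∀ v → adj v v ≡ false

open Graph public

Edge : ∀ {n} → Graph n → Fin n → Fin n → Set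
Edge G u v = adj G u v ≡ true

data WalkBy {n : ℕ} (R : Fin n → Fin n → Set) : Fin n → Fin n → Set where
  here : ∀ {v} → WalkBy R v v
  step : ∀ {u w v} → R u w → WalkBy R w v → WalkBy R u v

Connected : ∀ {n} → Graph n → Set
Connected G = ∀ u v → WalkBy (Edge G) u v

Cycle : ∀ {n} → Graph n → Set
Cycle {n} G = Σ ℕ λ l → Σ (Fin (3 + l) → Fin n) λ c →
  Injective _≡_ _≡_ c ×
  (∀ (i : Fin (2 + l)) → Edge G (c (inject₁ i)) (c (fsuc i))) ×
  Edge G (c (fromℕ (2 + l))) (c fzero)

IsTree : ∀ {m} → Graph m → Set
IsTree {m} T = 1 ≤ m × Connected T × ¬ Cycle T

bagSize : ∀ {n} → (Fin n → Bool) → ℕ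
bagSize {n} B = sum (map (λ v → if B v then 1 else 0) (allFin n))

record TreeDecomposition {n : ℕ} (G : Graph n) : Set where
  field
    m       : ℕ
    T       : Graph m
    isTree  : IsTree T
    bag     : Fin m → Fin n → Bool
    cover-v : ∀ v → ∃ λ t → bag t v ≡ true
    cover-e : ∀ u v → Edge G u v → ∃ λ t → bag t u ≡ true × bag t v ≡ true
    subtree : ∀ v s t → bag s v ≡ true → bag t v ≡ true →
              WalkBy (λ x y → Edge T x y × bag x v ≡ true × bag y v ≡ true) s t

open TreeDecomposition public

HasDecompBags≤ : ∀ {n} → Graph n → ℕ → Set
HasDecompBags≤ G b = Σ (TreeDecomposition G) λ D → ∀ t → bagSize (bag D t) ≤ b

-- tree-width of G equals k (k = min over decompositions of (max bag size - 1))
Treewidth≡ : ∀ {n} → Graph n → ℕ → Set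
Treewidth≡ G k = HasDecompBags≤ G (suc k) × ¬ HasDecompBags≤ G k

record VertexOrder (n : ℕ) : Set where
  field
    pos    : Fin n → Fin n
    pos-inj : Injective _≡_ _≡_ pos

open VertexOrder public

Cross : ∀ {n} → VertexOrder n → Fin n → Fin n → Fin n → Fin n → Set
Cross O u v x y =
  (a < c × c < b × b < d) ⊎ (c < a × a < d × d < b)
  where
  a = toℕ (pos O u) ⊓ toℕ (pos O v)
  b = toℕ (pos O u) ⊔ toℕ (pos O v)
  c = toℕ (pos O x) ⊓ toℕ (pos O y)
  d = toℕ (pos O x) ⊔ toℕ (pos O y)

-- a page assignment with pages in P: a function on edges (given as a
-- symmetric function on vertex pairs; values on non-edges are irrelevant)
record PageAssignment {n : ℕ} (P : Set) : Set where
  field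
    page     : Fin n → Fin n → P
    page-sym : ∀ u v → page u v ≡ page v u

open PageAssignment public

IsBook : ∀ {n} {P : Set} → Graph n → VertexOrder n → PageAssignment {n} P → Set
IsBook G O π = ∀ u v x y → Edge G u v → Edge G x y →
  page π u v ≡ page π x y → ¬ Cross O u v x y

IsLocal : ∀ {n} → Graph n → PageAssignment {n} ℕ → ℕ → Set
IsLocal G π k = ∀ v → Σ (List ℕ) λ L → length L ≤ k ×
  (∀ u → Edge G v u → page π v u ∈ L)

HasLocalBook : ∀ {n} → Graph n → ℕ → Set
HasLocalBook {n} G k = Σ (VertexOrder n) λ O → Σ (PageAssignment {n} ℕ) λ π →
  IsBook G O π × IsLocal G π k

LocalPageNumber≡ : ∀ {n} → Graph n → ℕ → Set
LocalPageNumber≡ G q = HasLocalBook G q × (∀ k → HasLocalBook G k → q ≤ k)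

-- union embedding: within each connected component of each G_P no two edges
-- cross.  Edges uv, xy of page P lie in the same component of G_P iff there
-- is a walk from u to x using edges of page P only.
IsUnion : ∀ {n} {P : Set} → Graph n → VertexOrder n → PageAssignment {n} P → Set
IsUnion G O π = ∀ u v x y → Edge G u v → Edge G x y →
  page π u v ≡ page π x y →
  WalkBy (λ a b → Edge G a b × page π a b ≡ page π u v) u x →
  ¬ Cross O u v x y

HasUnionEmb : ∀ {n} → Graph n → ℕ → Set
HasUnionEmb {n} G p = Σ (VertexOrder n) λ O → Σ (PageAssignment {n} (Fin p)) λ π →
  IsUnion G O π

UnionPageNumber≡ : ∀ {n} → Graph n → ℕ → Set
UnionPageNumber≡ G p = HasUnionEmb G p × (∀ p' → HasUnionEmb G p' → p ≤ p')

{-# OPTIONS --safe #-}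
-- The witness is the complete bipartite graph K_{k,N} with N large compared to k.
--
-- Colouring the k stars centred in the small side by k different colours gives a book
-- embedding with k pages, so both page numbers are at most k.  Conversely, fix an order and
-- suppose that every vertex meets c < k pages.  By pigeonhole every leaf t (a vertex of the
-- large side) sends two edges, to s_i and s_j, into one page, and for two leaves t, t' the
-- pair (i, j), this page, and the sides of s_i and s_j on which the leaf lies are the same.
-- Then one of t s_i, t' s_j and t' s_i, t s_j is a crossing pair, and these four edges form
-- a connected subgraph of one page.  So this bounds both numbers from below at once.
--
-- The tree-width is at least the minimum degree k: if no bag contains a closed
-- neighbourhood, one can forever walk through the decomposition tree without backtracking,
-- always towards a vertex of the graph that is missing in the node just left, but a forest
-- has no infinite walk of this kind.
module Submission where

open import Defs
open import Data.Bool using (Bool; true; false; if_then_else_)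
import Data.Bool.Properties as Bool
open import Data.Fin as Fin
  using (Fin; toℕ; inject₁; inject≤; fromℕ; splitAt; join; _↑ˡ_; _↑ʳ_; combine)
  renaming (zero to fzero; suc to fsuc)
import Data.Fin.Properties as Fin
open import Data.List using (List; []; _∷_; length; map; allFin; filter; lookup)
open import Data.List.Membership.Propositional using (_∈_)
open import Data.List.Membership.Propositional.Properties
  using (∈-filter⁺; ∈-filter⁻; ∈-allFin; ∈-map⁺; ∈-lookup)
open import Data.List.Properties using (length-map; length-tabulate)
open import Data.List.Relation.Unary.All as All using ()
open import Data.List.Relation.Unary.AllPairs using (_∷_)
open import Data.List.Relation.Unary.Any using (index)
open import Data.List.Relation.Unary.Any.Properties using (lookup-index)
open import Data.List.Relation.Unary.Unique.Propositional using (Unique)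
open import Data.List.Relation.Unary.Unique.Propositional.Properties using (allFin⁺; filter⁺)
open import Data.Nat using (ℕ; zero; suc; _+_; _*_; _≤_; _<_; _⊓_; _⊔_; z≤n; s≤s; s≤s⁻¹)
open import Data.Nat.Induction using (<-rec)
open import Data.Nat.ListAction using (sum)
open import Data.Nat.Properties
open import Data.Product using (Σ; ∃; ∃₂; _×_; _,_; proj₁; proj₂)
open import Data.Sum as Sum using (_⊎_; inj₁; inj₂)
open import Function using (id; _∘_)
open import Function.Definitions using (Injective)
open import Relation.Binary.Definitions using (Tri; tri<; tri≈; tri>)
open import Relation.Binary.PropositionalEquality as ≡
  using (_≡_; _≢_; refl; trans; cong; subst)
open import Relation.Nullary using (¬_; Dec; yes; no; does; contradiction)
open import Relation.Nullary.Decidable using (_×-dec_; dec-true)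

private variable
  n : ℕ

false≢true : ∀ {b} → b ≡ false → b ≢ true
false≢true refl ()

-- Bag sizes

lookup-injective : ∀ {A : Set} {xs : List A} → Unique xs → Injective _≡_ _≡_ (lookup xs)
lookup-injective (x∉ ∷ _) {fzero} {fzero} _ = refl
lookup-injective (x∉ ∷ _) {fzero} {fsuc j} eq = contradiction eq (All.lookup x∉ (∈-lookup j))
lookup-injective (x∉ ∷ _) {fsuc i} {fzero} eq = contradiction (≡.sym eq) (All.lookup x∉ (∈-lookup i))
lookup-injective (_ ∷ u) {fsuc i} {fsuc j} eq = cong fsuc (lookup-injective u eq)

module _ (B : Fin n → Bool) where

  private
    B? : ∀ v → Dec (B v ≡ true)
    B? v = B v Bool.≟ true

  members : List (Fin n)
  members = filter B? (allFin n)

  bagSize≡length-members : bagSize B ≡ length members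
  bagSize≡length-members = go (allFin n)
    where
    go : ∀ vs → sum (map (λ v → if B v then 1 else 0) vs) ≡ length (filter B? vs)
    go [] = refl
    go (v ∷ vs) with B v
    ... | true  = cong suc (go vs)
    ... | false = go vs

  injection⇒≤bagSize : ∀ {a} (f : Fin a → Fin n) → Injective _≡_ _≡_ f →
                       (∀ i → B (f i) ≡ true) → a ≤ bagSize B
  injection⇒≤bagSize f f-inj Bf rewrite bagSize≡length-members =
    Fin.injective⇒≤ {f = λ i → index (f∈ i)} λ {i} {j} eq →
      f-inj (trans (lookup-index (f∈ i))
        (trans (cong (lookup members) eq) (≡.sym (lookup-index (f∈ j)))))
    where
    f∈ : ∀ i → f i ∈ members
    f∈ i = ∈-filter⁺ B? (∈-allFin (f i)) (Bf i)

  injectiveOn⇒bagSize≤ : ∀ {b} (g : Fin n → Fin b) →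
                         (∀ u v → B u ≡ true → B v ≡ true → g u ≡ g v → u ≡ v) →
                         bagSize B ≤ b
  injectiveOn⇒bagSize≤ g g-inj rewrite bagSize≡length-members =
    Fin.injective⇒≤ {f = g ∘ lookup members} λ {i} {j} eq →
      lookup-injective (filter⁺ B? (allFin⁺ n)) (g-inj _ _ (B-lookup i) (B-lookup j) eq)
    where
    B-lookup : ∀ i → B (lookup members i) ≡ true
    B-lookup i = proj₂ (∈-filter⁻ B? {xs = allFin n} (∈-lookup i))

-- Walks without backtracking

module _ {m : ℕ} (T : Graph m) where

  -- Among the first `m + 1` nodes two coincide, which gives a closed part of the walk; a closed
  -- part without further repetition is a cycle.
  infinite-walk⇒cycle : (x : ℕ → Fin m) → (∀ i → Edge T (x i) (x (suc i))) →
                        (∀ i → x (2 + i) ≢ x i) → Cycle T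
  infinite-walk⇒cycle x edge nonback =
    let i , j , i<j , eq = Fin.pigeonhole (n<1+n m) (x ∘ toℕ)
        g , 1+i+g≡j      = m≤n⇒∃[o]m+o≡n i<j
    in closed⇒cycle g (toℕ i)
         (trans eq (cong x (≡.sym (trans (+-suc (toℕ i) g) 1+i+g≡j))))
    where
    -- Induction on the length: a closed part that visits a node twice contains a shorter one.
    closed⇒cycle : ∀ g i → x i ≡ x (i + suc g) → Cycle T
    closed⇒cycle = <-rec _ go
      where
      go : ∀ g → (∀ {h} → h < g → ∀ i → x i ≡ x (i + suc h) → Cycle T) →
           ∀ i → x i ≡ x (i + suc g) → Cycle T
      -- `g` is the length minus one: length 1 would be a loop and length 2 a step back, so at least
      -- the three nodes that `Cycle` asks for remain.
      go 0 rec i eq =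
        contradiction (trans (cong (adj T (x i)) (trans eq (cong x (+-comm i 1)))) (edge i))
                      (false≢true (irrefl T (x i)))
      go 1 rec i eq = contradiction (≡.sym (trans eq (cong x (+-comm i 2)))) (nonback i)
      go (suc (suc l)) rec i eq
        with Fin.any? (λ a → Fin.any? (λ b →
               (a Fin.<? b) ×-dec (x (i + toℕ {3 + l} a) Fin.≟ x (i + toℕ {3 + l} b))))
      ... | yes (a , b , a<b , eq′) =
        let h , 1+a+h≡b = m≤n⇒∃[o]m+o≡n a<b
        in rec (s≤s⁻¹ (≤-trans (s≤s (s≤s (m≤n+m h (toℕ a))))
                        (≤-trans (≤-reflexive (cong suc 1+a+h≡b)) (Fin.toℕ<n b))))
               (i + toℕ a)
               (trans eq′ (cong x (trans (cong (i +_) (≡.sym (trans (+-suc (toℕ a) h) 1+a+h≡b)))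
                                         (≡.sym (+-assoc i (toℕ a) (suc h))))))
      ... | no distinct = l , c , c-injective , c-edge , c-close
        where
        c : Fin (3 + l) → Fin m
        c a = x (i + toℕ a)

        c-injective : Injective _≡_ _≡_ c
        c-injective {a} {b} eq′ with Fin.<-cmp a b
        ... | tri< a<b _ _ = contradiction (a , b , a<b , eq′) distinct
        ... | tri≈ _ a≡b _ = a≡b
        ... | tri> _ _ b<a = contradiction (b , a , b<a , ≡.sym eq′) distinct

        c-edge : ∀ a → Edge T (c (inject₁ a)) (c (fsuc a))
        c-edge a rewrite Fin.toℕ-inject₁ a | +-suc i (toℕ a) = edge (i + toℕ a)

        c-close : Edge T (c (fromℕ (2 + l))) (c fzero)
        c-close rewrite Fin.toℕ-fromℕ l | +-identityʳ i | eq | +-suc i (2 + l) = edge (i + (2 + l))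

-- The first index is the node that the next step must avoid. Keeping it in the type lets a walk be
-- used up from the front.
data NonBacktracking {m : ℕ} (R : Fin m → Fin m → Set) : Fin m → Fin m → Fin m → Set where
  here : ∀ {p x} → NonBacktracking R p x x
  step : ∀ {p x y z} → R x y → y ≢ p → NonBacktracking R x y z → NonBacktracking R p x z

data Reduced {m : ℕ} (R : Fin m → Fin m → Set) : Fin m → Fin m → Set where
  here : ∀ {x} → Reduced R x x
  step : ∀ {x y z} → R x y → NonBacktracking R x y z → Reduced R x z

module _ {m : ℕ} {R : Fin m → Fin m → Set} where

  reduce : ∀ {x z} → WalkBy R x z → Reduced R x z
  reduce here = here
  reduce {x} (step r w) with reduce w
  ... | here = step r here
  ... | step {y = y} r′ nb with y Fin.≟ x
  ...   | no y≢x = step r (step r′ y≢x nb)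
  -- The new step and the one after it cancel. The remaining walk starts at `x`, and its first step
  -- no longer has a node to avoid.
  ...   | yes refl with nb
  ...     | here = here
  ...     | step r″ _ nb′ = step r″ nb′

  mapNonBacktracking : ∀ {S : Fin m → Fin m → Set} → (∀ {x y} → R x y → S x y) →
                       ∀ {p x z} → NonBacktracking R p x z → NonBacktracking S p x z
  mapNonBacktracking f here = here
  mapNonBacktracking f (step r y≢p nb) = step (f r) y≢p (mapNonBacktracking f nb)

-- Lower bound for the tree-width

module _ {n : ℕ} {G : Graph n} (D : TreeDecomposition G) where

  private
    -- A position on the walk: some v that is missing in the bag of the previous node lies
    -- ahead.
    record State : Set where
      constructor state
      field
        {prev cur target} : Fin (m D)
        {v}     : Fin n
        edge    : Edge (T D) prev cur
        missing : bag D prev v ≡ false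
        found   : bag D target v ≡ true
        ahead   : NonBacktracking (Edge (T D)) prev cur target

    open State

  -- The negated assumption keeps `advance` from ever getting stuck, so the current nodes of
  -- `states` form an infinite walk, impossible in a tree. `v₀` starts it; without vertices the
  -- assumption would be vacuous.
  closed-nbhd-in-bag : Fin n → ¬ (∀ x v → ∃ λ u → (u ≡ v ⊎ Edge G v u) × bag D x u ≡ false)
  closed-nbhd-in-bag v₀ outside =
    proj₂ (proj₂ (isTree D))
      (infinite-walk⇒cycle (T D) (cur ∘ states)
        (λ i → subst (λ x → Edge (T D) x (cur (states (suc i)))) (prev-next (states i))
                 (edge (states (suc i))))
        (λ i eq → next-nonback (states (suc i)) (trans eq (≡.sym (prev-next (states i))))))
    where
    advance : (s : State) → Σ State λ s′ → prev s′ ≡ cur s × cur s′ ≢ prev s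
    advance (state {x} {y} {z} {v} x~y v∉x v∈z walk) with bag D y v in eq
    -- While `v` is missing at the current node, the target is not reached yet and the planned walk
    -- is followed.
    advance (state x~y v∉x v∈z here) | false = contradiction v∈z (false≢true eq)
    advance (state x~y v∉x v∈z (step y~w w≢x walk)) | false = state y~w eq v∈z walk , refl , w≢x
    -- Once `v` is reached, the new goal is a neighbour `u` of `v` missing here. Some bag holds
    -- both, and the subtree of `v` leads to it.
    advance (state {x} {y} {z} {v} x~y v∉x v∈z walk) | true with outside y v
    ... | u , inj₁ refl , u∉y = contradiction eq (false≢true u∉y)
    ... | u , inj₂ v~u , u∉y with cover-e D v u v~u
    ...   | z′ , v∈z′ , u∈z′ with reduce (subtree D v y z′ eq v∈z′)
    ...     | here = contradiction u∈z′ (false≢true u∉y)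
    ...     | step (y~w , _ , v∈w) walk′ =
      state y~w u∉y u∈z′ (mapNonBacktracking proj₁ walk′) , refl ,
      -- The first step stays among bags containing `v`, and the previous bag does not contain `v`,
      -- so it does not go back.
      λ { refl → false≢true v∉x v∈w }

    next : State → State
    next s = proj₁ (advance s)

    prev-next : ∀ s → prev (next s) ≡ cur s
    prev-next s = proj₁ (proj₂ (advance s))

    next-nonback : ∀ s → cur (next s) ≢ prev s
    next-nonback s = proj₂ (proj₂ (advance s))

    start : State
    start with cover-v D v₀
    ... | r , _ with outside r v₀
    ...   | u , _ , u∉r with cover-v D u
    ...     | z , u∈z with reduce (proj₁ (proj₂ (isTree D)) r z)
    ...       | here = contradiction u∈z (false≢true u∉r)
    ...       | step r~y walk = state r~y u∉r u∈z walk

    states : ℕ → State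
    states zero = start
    states (suc i) = next (states i)

module _ {n d : ℕ} (G : Graph n) (nbr : Fin n → Fin d → Fin n)
         (nbr-inj : ∀ v → Injective _≡_ _≡_ (nbr v)) (nbr-edge : ∀ v i → Edge G v (nbr v i)) where

  -- A closed neighbourhood has at least `suc d` vertices, too many for a bag of size at most `d`.
  min-degree⇒¬bags≤ : Fin n → ¬ HasDecompBags≤ G d
  min-degree⇒¬bags≤ v₀ (D , small) = closed-nbhd-in-bag D v₀ outside
    where
    outside : ∀ x v → ∃ λ u → (u ≡ v ⊎ Edge G v u) × bag D x u ≡ false
    outside x v with bag D x v in eq
    ... | false = v , inj₁ refl , eq
    ... | true with Fin.any? (λ i → bag D x (nbr v i) Bool.≟ false)
    ...   | yes (i , ∉x) = nbr v i , inj₂ (nbr-edge v i) , ∉x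
    ...   | no all∈x = contradiction (injection⇒≤bagSize (bag D x) f f-inj f∈x) (≤⇒≯ (small x))
      where
      f : Fin (suc d) → Fin n
      f fzero = v
      f (fsuc i) = nbr v i

      v≢nbr : ∀ i → v ≢ nbr v i
      v≢nbr i eq′ = false≢true (irrefl G v) (subst (Edge G v) (≡.sym eq′) (nbr-edge v i))

      f-inj : Injective _≡_ _≡_ f
      f-inj {fzero} {fzero} _ = refl
      f-inj {fzero} {fsuc j} eq′ = contradiction eq′ (v≢nbr j)
      f-inj {fsuc i} {fzero} eq′ = contradiction (≡.sym eq′) (v≢nbr i)
      f-inj {fsuc i} {fsuc j} eq′ = cong fsuc (nbr-inj v eq′)

      f∈x : ∀ i → bag D x (f i) ≡ true
      f∈x fzero = eq
      f∈x (fsuc i) = Bool.¬-not (λ ∉x → all∈x (i , ∉x))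

-- Crossing pairs

-- `Cross O u v x y` unfolds to this at the four positions, so crossings can be treated as facts
-- about numbers.
Interleave : ℕ → ℕ → ℕ → ℕ → Set
Interleave p q r s =
  (p ⊓ q < r ⊓ s × r ⊓ s < p ⊔ q × p ⊔ q < r ⊔ s) ⊎
  (r ⊓ s < p ⊓ q × p ⊓ q < r ⊔ s × r ⊔ s < p ⊔ q)

interleave-sym : ∀ {p q r s} → Interleave p q r s → Interleave r s p q
interleave-sym = Sum.swap

interleave-swapˡ : ∀ {p q r s} → Interleave p q r s → Interleave q p r s
interleave-swapˡ {p} {q} I rewrite ⊓-comm q p | ⊔-comm q p = I

interleave-swapʳ : ∀ {p q r s} → Interleave p q r s → Interleave p q s r
interleave-swapʳ {p} {q} {r} {s} I rewrite ⊓-comm s r | ⊔-comm s r = I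

<⇒interleave : ∀ {a b c d} → a < c → c < b → b < d → Interleave a b c d
<⇒interleave a<c c<b b<d
  rewrite m≤n⇒m⊓n≡m (<⇒≤ (<-trans a<c c<b)) | m≤n⇒m⊔n≡n (<⇒≤ (<-trans a<c c<b))
        | m≤n⇒m⊓n≡m (<⇒≤ (<-trans c<b b<d)) | m≤n⇒m⊔n≡n (<⇒≤ (<-trans c<b b<d))
  = inj₁ (a<c , c<b , b<d)

-- In a crossing the four ends are strictly ordered, so no end of one pair equals an end of the
-- other.
¬interleave-common : ∀ p q r → ¬ Interleave p q p r
¬interleave-common p q r = λ where
    (inj₁ (a<c , c<b , b<d)) → apart a<c c<b b<d (end q) (end r)
    (inj₂ (c<a , a<d , d<b)) → apart c<a a<d d<b (end r) (end q)
  where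
  end : ∀ q → p ⊓ q ≡ p ⊎ p ⊔ q ≡ p
  end q with ≤-total p q
  ... | inj₁ p≤q = inj₁ (m≤n⇒m⊓n≡m p≤q)
  ... | inj₂ q≤p = inj₂ (m≥n⇒m⊔n≡m q≤p)

  apart : ∀ {a b c d} → a < c → c < b → b < d → a ≡ p ⊎ b ≡ p → ¬ (c ≡ p ⊎ d ≡ p)
  apart a<c c<b b<d (inj₁ refl) (inj₁ refl) = <-irrefl refl a<c
  apart a<c c<b b<d (inj₁ refl) (inj₂ refl) = <-irrefl refl (<-trans a<c (<-trans c<b b<d))
  apart a<c c<b b<d (inj₂ refl) (inj₁ refl) = <-irrefl refl c<b
  apart a<c c<b b<d (inj₂ refl) (inj₂ refl) = <-irrefl refl b<d

-- The value lies in `Fin 2` so that it can enter a pigeonhole key. Ties fall to the second value;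
-- positions of leaves and centres never tie.
side : ℕ → ℕ → Fin 2
side p q with p <? q
... | yes _ = fzero
... | no _  = fsuc fzero

side-< : ∀ {p p′} q → side p q ≡ side p′ q → p < q → p′ < q
side-< {p} {p′} q eq p<q with p <? q | p′ <? q
... | _      | yes p′<q = p′<q
... | no p≮q | no _     = contradiction p<q p≮q
side-< q () p<q | yes _ | no _

-- Neither `x` nor `y` separates `t` from `t′`, so the order is `t t′ x y`, `x t t′ y` or
-- `x y t t′`; in each, one of the two matchings crosses.
interleave-ordered : ∀ {t t′ x y} → t < t′ → x < y → x ≢ t → y ≢ t →
  (t < x → t′ < x) → (t < y → t′ < y) → Interleave t x t′ y ⊎ Interleave t′ x t y
interleave-ordered {t} {t′} {x} {y} t<t′ x<y x≢t y≢t x-side y-side with t <? x | t <? y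
... | yes t<x | _ = inj₁ (<⇒interleave t<t′ (x-side t<x) x<y)
... | no t≮x | yes t<y =
  inj₂ (interleave-swapˡ {x} (<⇒interleave (≤∧≢⇒< (≮⇒≥ t≮x) x≢t) t<t′ (y-side t<y)))
... | no _ | no t≮y =
  inj₁ (interleave-swapˡ {x} (interleave-swapʳ {x} (<⇒interleave x<y (≤∧≢⇒< (≮⇒≥ t≮y) y≢t) t<t′)))

-- Exchanging `t` with `t′`, or `x` with `y`, only exchanges the two matchings, so both pairs may be
-- taken increasing.
interleave-same-side : ∀ {t t′ x y} → t ≢ t′ → x ≢ y → x ≢ t → x ≢ t′ → y ≢ t → y ≢ t′ →
  side t x ≡ side t′ x → side t y ≡ side t′ y → Interleave t x t′ y ⊎ Interleave t′ x t y
interleave-same-side {t} {t′} {x} {y} t≢t′ x≢y x≢t x≢t′ y≢t y≢t′ x-side y-side =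
  go (<-cmp t t′) (<-cmp x y)
  where
  x→ = side-< {t} {t′} x x-side
  x← = side-< {t′} {t} x (≡.sym x-side)
  y→ = side-< {t} {t′} y y-side
  y← = side-< {t′} {t} y (≡.sym y-side)

  sym-both : Interleave t y t′ x ⊎ Interleave t′ y t x → Interleave t x t′ y ⊎ Interleave t′ x t y
  sym-both (inj₁ I) = inj₂ (interleave-sym {t} I)
  sym-both (inj₂ I) = inj₁ (interleave-sym {t′} I)

  go : Tri (t < t′) (t ≡ t′) (t′ < t) → Tri (x < y) (x ≡ y) (y < x) →
       Interleave t x t′ y ⊎ Interleave t′ x t y
  go (tri≈ _ t≡t′ _) _ = contradiction t≡t′ t≢t′
  go _ (tri≈ _ x≡y _) = contradiction x≡y x≢y
  go (tri< t<t′ _ _) (tri< x<y _ _) = interleave-ordered t<t′ x<y x≢t y≢t x→ y→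
  go (tri< t<t′ _ _) (tri> _ _ y<x) = sym-both (interleave-ordered t<t′ y<x y≢t x≢t y→ x→)
  go (tri> _ _ t′<t) (tri< x<y _ _) = Sum.swap (interleave-ordered t′<t x<y x≢t′ y≢t′ x← y←)
  go (tri> _ _ t′<t) (tri> _ _ y<x) =
    sym-both (Sum.swap (interleave-ordered t′<t y<x y≢t′ x≢t′ y← x←))

-- Complete bipartite graphs

opposite : ∀ {A B : Set} → A ⊎ B → A ⊎ B → Bool
opposite (inj₁ _) (inj₁ _) = false
opposite (inj₁ _) (inj₂ _) = true
opposite (inj₂ _) (inj₁ _) = true
opposite (inj₂ _) (inj₂ _) = false

opposite-sym : ∀ {A B : Set} (x y : A ⊎ B) → opposite x y ≡ opposite y x
opposite-sym (inj₁ _) (inj₁ _) = refl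
opposite-sym (inj₁ _) (inj₂ _) = refl
opposite-sym (inj₂ _) (inj₁ _) = refl
opposite-sym (inj₂ _) (inj₂ _) = refl

opposite-irrefl : ∀ {A B : Set} (x : A ⊎ B) → opposite x x ≡ false
opposite-irrefl (inj₁ _) = refl
opposite-irrefl (inj₂ _) = refl

K : ∀ k N → Graph (k + N)
K k N = record
  { adj    = λ u v → opposite (splitAt k u) (splitAt k v)
  ; sym    = λ u v → opposite-sym (splitAt k u) (splitAt k v)
  ; irrefl = λ v → opposite-irrefl (splitAt k v)
  }

splitAt-injective : ∀ k {N} {u v : Fin (k + N)} → splitAt k u ≡ splitAt k v → u ≡ v
splitAt-injective k {N} {u} {v} eq =
  trans (≡.sym (Fin.join-splitAt k N u)) (trans (cong (join k N) eq) (Fin.join-splitAt k N v))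

K₁-edge : ∀ {N} (u v : Fin (1 + N)) → Edge (K 1 N) u v → u ≡ fzero ⊎ v ≡ fzero
K₁-edge fzero _ _ = inj₁ refl
K₁-edge (fsuc _) fzero _ = inj₂ refl

K₁-isTree : ∀ N → IsTree (K 1 N)
K₁-isTree N = s≤s z≤n , connected , acyclic
  where
  connected : Connected (K 1 N)
  connected fzero fzero = here
  connected fzero (fsuc _) = step refl here
  connected (fsuc _) fzero = step {w = fzero} refl here
  connected (fsuc _) (fsuc _) = step {w = fzero} refl (step refl here)

  acyclic : ¬ Cycle (K 1 N)
  acyclic (l , c , c-inj , edge , close)
    -- All edges of a star share its centre, but no node lies on the first, the second and the
    -- closing edge of a cycle.
    with K₁-edge _ _ (edge fzero) | K₁-edge _ _ (edge (fsuc fzero)) | K₁-edge _ _ close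
  ... | inj₁ c₀ | inj₁ c₁ | _ with () ← c-inj (trans c₀ (≡.sym c₁))
  ... | inj₁ c₀ | inj₂ c₂ | _ with () ← c-inj (trans c₀ (≡.sym c₂))
  ... | inj₂ c₁ | _ | inj₁ c₋ with () ← c-inj (trans c₁ (≡.sym c₋))
  ... | inj₂ c₁ | _ | inj₂ c₀ with () ← c-inj (trans c₁ (≡.sym c₀))

module _ (k N : ℕ) where

  private
    centre : Fin k → Fin (k + N)
    centre i = i ↑ˡ N

    leaf : Fin N → Fin (k + N)
    leaf t = k ↑ʳ t

  edge-leaf-centre : ∀ t i → Edge (K k N) (leaf t) (centre i)
  edge-leaf-centre t i rewrite Fin.splitAt-↑ʳ k N t | Fin.splitAt-↑ˡ k i N = refl

  edge-centre-leaf : ∀ i t → Edge (K k N) (centre i) (leaf t)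
  edge-centre-leaf i t rewrite Fin.splitAt-↑ʳ k N t | Fin.splitAt-↑ˡ k i N = refl

  centre≢leaf : ∀ i t → centre i ≢ leaf t
  centre≢leaf i t eq
    with () ← trans (≡.sym (Fin.splitAt-↑ˡ k i N)) (trans (cong (splitAt k) eq) (Fin.splitAt-↑ʳ k N t))

  private
    inBag : Fin (1 + N) → Fin k ⊎ Fin N → Bool
    inBag _        (inj₁ _)  = true
    inBag fzero    (inj₂ _)  = false
    inBag (fsuc t) (inj₂ t′) = does (t Fin.≟ t′)

    inBag-leaf : ∀ x t → inBag x (inj₂ t) ≡ true → x ≡ fsuc t
    inBag-leaf (fsuc t′) t eq with t′ Fin.≟ t
    ... | yes refl = refl

  -- The tree is a star: its hub holds the centres, and each outer node adds one leaf. Hence `slot`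
  -- can send all leaves to one value.
  K-bags≤ : HasDecompBags≤ (K k N) (suc k)
  K-bags≤ = D , λ x → injectiveOn⇒bagSize≤ (bag D x) (slot ∘ splitAt k)
                 λ u v u∈ v∈ eq → splitAt-injective k (slot-inj x (splitAt k u) (splitAt k v) u∈ v∈ eq)
    where
    D : TreeDecomposition (K k N)
    m D = 1 + N
    T D = K 1 N
    isTree D = K₁-isTree N
    bag D x v = inBag x (splitAt k v)
    cover-v D v with splitAt k v
    ... | inj₁ _ = fzero , refl
    ... | inj₂ t = fsuc t , dec-true (t Fin.≟ t) refl
    cover-e D u v e with splitAt k u | splitAt k v
    ... | inj₁ _ | inj₂ t = fsuc t , refl , dec-true (t Fin.≟ t) refl
    ... | inj₂ t | inj₁ _ = fsuc t , dec-true (t Fin.≟ t) refl , refl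
    subtree D v x y v∈x v∈y with splitAt k v
    ... | inj₂ t rewrite inBag-leaf x t v∈x | inBag-leaf y t v∈y = here
    ... | inj₁ _ = mapWalk (λ x~y → x~y , refl , refl) (proj₁ (proj₂ (K₁-isTree N)) x y)
      where
      mapWalk : ∀ {n} {R S : Fin n → Fin n → Set} → (∀ {x y} → R x y → S x y) →
                ∀ {x y} → WalkBy R x y → WalkBy S x y
      mapWalk f here = here
      mapWalk f (step r w) = step (f r) (mapWalk f w)

    slot : Fin k ⊎ Fin N → Fin (suc k)
    slot (inj₁ i) = fsuc i
    slot (inj₂ _) = fzero

    slot-inj : ∀ x a b → inBag x a ≡ true → inBag x b ≡ true → slot a ≡ slot b → a ≡ b
    slot-inj x (inj₁ _) (inj₁ _) _ _ refl = refl
    slot-inj x (inj₂ s) (inj₂ t) s∈ t∈ _ =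
      cong inj₂ (Fin.suc-injective (trans (≡.sym (inBag-leaf x s s∈)) (inBag-leaf x t t∈)))

  -- Every vertex has `k` distinct neighbours: a leaf has the centres, a centre the first `k`
  -- leaves.
  K-¬bags≤ : 1 ≤ N → k ≤ N → ¬ HasDecompBags≤ (K k N) k
  K-¬bags≤ 1≤N k≤N = min-degree⇒¬bags≤ (K k N) nbr nbr-inj nbr-edge (leaf (inject≤ fzero 1≤N))
    where
    nbr′ : Fin k ⊎ Fin N → Fin k → Fin (k + N)
    nbr′ (inj₁ _) i = leaf (inject≤ i k≤N)
    nbr′ (inj₂ _) i = centre i

    nbr : Fin (k + N) → Fin k → Fin (k + N)
    nbr v = nbr′ (splitAt k v)

    nbr-inj : ∀ v → Injective _≡_ _≡_ (nbr v)
    nbr-inj v eq with splitAt k v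
    ... | inj₁ _ = Fin.inject≤-injective k≤N k≤N _ _ (Fin.↑ʳ-injective k _ _ eq)
    ... | inj₂ _ = Fin.↑ˡ-injective N _ _ eq

    nbr-edge : ∀ v i → Edge (K k N) v (nbr v i)
    nbr-edge v i with splitAt k v
    ... | inj₁ _ rewrite Fin.splitAt-↑ʳ k N (inject≤ i k≤N) = refl
    ... | inj₂ _ rewrite Fin.splitAt-↑ˡ k i N = refl

K-treewidth : ∀ k N → 1 ≤ N → k ≤ N → Treewidth≡ (K k N) k
K-treewidth k N 1≤N k≤N = K-bags≤ k N , K-¬bags≤ k N 1≤N k≤N

-- Embeddings

-- Counting pages globally gives a common source for both upper bounds.
HasBook : Graph n → ℕ → Set
HasBook {n} G p = Σ (VertexOrder n) λ O → Σ (PageAssignment {n} (Fin p)) λ π → IsBook G O π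

book⇒union : ∀ (G : Graph n) {p} → HasBook G p → HasUnionEmb G p
book⇒union G (O , π , book) = O , π , λ u v x y e e′ eq _ → book u v x y e e′ eq

book⇒local : ∀ (G : Graph n) {p} → HasBook G p → HasLocalBook G p
book⇒local G {p} (O , π , book) =
  O ,
  record { page = λ u v → toℕ (page π u v) ; page-sym = λ u v → cong toℕ (page-sym π u v) } ,
  (λ u v x y e e′ eq → book u v x y e e′ (Fin.toℕ-injective eq)) ,
  λ v → map toℕ (allFin p) ,
        ≤-reflexive (trans (length-map toℕ (allFin p)) (length-tabulate id)) ,
        λ u _ → ∈-map⁺ toℕ (∈-allFin (page π v u))

-- Each page is a star, and edges with a common end never cross, so any order works.
K-book : ∀ k N → HasBook (K (suc k) N) (suc k)
K-book k N = O , π , book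
  where
  G = K (suc k) N

  O : VertexOrder (suc k + N)
  O = record { pos = id ; pos-inj = id }

  star : Fin (suc k) ⊎ Fin N → Fin (suc k) ⊎ Fin N → Fin (suc k)
  star (inj₁ i) (inj₂ _) = i
  star (inj₂ _) (inj₁ i) = i
  -- A default for non-edges, available because there is at least one page.
  star _        _        = fzero

  star-sym : ∀ a b → star a b ≡ star b a
  star-sym (inj₁ _) (inj₁ _) = refl
  star-sym (inj₁ _) (inj₂ _) = refl
  star-sym (inj₂ _) (inj₁ _) = refl
  star-sym (inj₂ _) (inj₂ _) = refl

  π : PageAssignment (Fin (suc k))
  π = record { page = λ u v → star (splitAt (suc k) u) (splitAt (suc k) v)
             ; page-sym = λ u v → star-sym (splitAt (suc k) u) (splitAt (suc k) v) }

  star-centre : ∀ u v → Edge G u v → ∃ λ i → page π u v ≡ i × (i ↑ˡ N ≡ u ⊎ i ↑ˡ N ≡ v)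
  star-centre u v e with splitAt (suc k) u in u-eq | splitAt (suc k) v in v-eq
  ... | inj₁ i | inj₂ _ = i , refl , inj₁ (Fin.splitAt⁻¹-↑ˡ u-eq)
  ... | inj₂ _ | inj₁ i = i , refl , inj₂ (Fin.splitAt⁻¹-↑ˡ v-eq)

  book : IsBook G O π
  book u v x y e e′ eq I with star-centre u v e | star-centre x y e′
  ... | i , i-eq , c | i′ , i′-eq , c′ with trans (≡.sym i-eq) (trans eq i′-eq)
  ... | refl with c | c′
  ... | inj₁ refl | inj₁ refl = ¬interleave-common _ _ _ I
  ... | inj₁ refl | inj₂ refl = ¬interleave-common _ _ _ (interleave-swapʳ {toℕ u} I)
  ... | inj₂ refl | inj₁ refl = ¬interleave-common _ _ _ (interleave-swapˡ {toℕ u} I)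
  ... | inj₂ refl | inj₂ refl =
    ¬interleave-common _ _ _ (interleave-swapˡ {toℕ u} (interleave-swapʳ {toℕ u} I))

-- Each vertex numbers its own pages, and a page may receive several numbers. This covers both `p`
-- pages in total and the page lists of `IsLocal`.
PagesPerVertex≤ : ∀ {P : Set} → Graph n → PageAssignment {n} P → ℕ → Set
PagesPerVertex≤ {n} G π c =
  Σ (∀ v u → Edge G v u → Fin c) λ idx →
    ∀ v u u′ e e′ → idx v u e ≡ idx v u′ e′ → page π v u ≡ page π v u′

pages⇒pagesPerVertex : ∀ (G : Graph n) {p} (π : PageAssignment (Fin p)) → PagesPerVertex≤ G π p
pages⇒pagesPerVertex G π = (λ v u _ → page π v u) , λ _ _ _ _ _ eq → eq

local⇒pagesPerVertex : ∀ (G : Graph n) π {c} → IsLocal G π c → PagesPerVertex≤ G π c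
local⇒pagesPerVertex G π loc =
  (λ v u e → let L , |L|≤c , on = loc v in inject≤ (index (on u e)) |L|≤c) ,
  λ v u u′ e e′ eq → let L , |L|≤c , on = loc v in
    trans (lookup-index (on u e))
      (trans (cong (lookup L) (Fin.inject≤-injective |L|≤c |L|≤c _ _ eq))
             (≡.sym (lookup-index (on u′ e′))))

-- Lower bound for both page numbers

module _ {k N c : ℕ} (c<k : c < k) (N-large : k * (k * (c * 4)) < N)
         {P : Set} (O : VertexOrder (k + N)) (π : PageAssignment {k + N} P) where

  K-¬union : PagesPerVertex≤ (K k N) π c → ¬ IsUnion (K k N) O π
  K-¬union (idx , idx-page) union =
    let t , t′ , t<t′ , eq = Fin.pigeonhole N-large (λ t → key t (first t) (second t))
    in collide (Fin.<⇒≢ t<t′) (Fin.<⇒≢ (first<second t)) (same-page t) (same-page t′) eq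
    where
    centre : Fin k → Fin (k + N)
    centre i = i ↑ˡ N

    leaf : Fin N → Fin (k + N)
    leaf t = k ↑ʳ t

    leaf-centre : ∀ t i → Edge (K k N) (leaf t) (centre i)
    leaf-centre = edge-leaf-centre k N

    centre-leaf : ∀ i t → Edge (K k N) (centre i) (leaf t)
    centre-leaf = edge-centre-leaf k N

    place : Fin (k + N) → ℕ
    place v = toℕ (pos O v)

    place-≢ : ∀ {u v} → u ≢ v → place u ≢ place v
    place-≢ u≢v eq = u≢v (pos-inj O (Fin.toℕ-injective eq))

    place-centre≢leaf : ∀ i t → place (centre i) ≢ place (leaf t)
    place-centre≢leaf i t = place-≢ (centre≢leaf k N i t)

    two-edges : ∀ t → ∃₂ λ i j → i Fin.< j ×
                idx (leaf t) (centre i) (leaf-centre t i) ≡ idx (leaf t) (centre j) (leaf-centre t j)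
    two-edges t = Fin.pigeonhole c<k (λ i → idx (leaf t) (centre i) (leaf-centre t i))

    first second : Fin N → Fin k
    first t = proj₁ (two-edges t)
    second t = proj₁ (proj₂ (two-edges t))

    first<second : ∀ t → first t Fin.< second t
    first<second t = proj₁ (proj₂ (proj₂ (two-edges t)))

    -- The page is recorded by its number at `centre i`, a vertex common to both leaves, since
    -- numbers taken at different vertices are not comparable. The factor 4 counts the two sides.
    key : Fin N → Fin k → Fin k → Fin (k * (k * (c * 4)))
    key t i j =
      combine i (combine j (combine (idx (centre i) (leaf t) (centre-leaf i t))
        (combine (side (place (leaf t)) (place (centre i))) (side (place (leaf t)) (place (centre j))))))

    SamePage : Fin N → Fin k → Fin k → Set
    SamePage t i j = page π (leaf t) (centre i) ≡ page π (leaf t) (centre j)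

    same-page : ∀ t → SamePage t (first t) (second t)
    same-page t = idx-page _ _ _ _ _ (proj₂ (proj₂ (proj₂ (two-edges t))))

    -- The path `leaf t`, `centre i`, `leaf t′` stays in one page, which puts both edges in one
    -- component.
    no-crossing : ∀ {t t′ i j} → page π (centre i) (leaf t) ≡ page π (centre i) (leaf t′) →
                  SamePage t′ i j → ¬ Cross O (leaf t) (centre i) (leaf t′) (centre j)
    no-crossing {t} {t′} {i} {j} eq eq′ =
      union _ _ _ _ (leaf-centre t i) (leaf-centre t′ j)
        (trans (page-sym π _ _) (trans eq (trans (page-sym π _ _) eq′)))
        (step (leaf-centre t i , refl)
          (step (centre-leaf i t′ , trans (≡.sym eq) (page-sym π _ _)) here))

    collide : ∀ {t t′ i j i′ j′} → t ≢ t′ → i ≢ j → SamePage t i j → SamePage t′ i′ j′ →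
              key t i j ≢ key t′ i′ j′
    collide {t} {t′} {i} {j} {i′} {j′} t≢t′ i≢j same same′ eq
      -- The centres are identified first; only then does equality of the numbers give equality of
      -- pages.
      with refl , eq₁ ← Fin.combine-injective i _ i′ _ eq
      with refl , eq₂ ← Fin.combine-injective j _ j′ _ eq₁
      with idx≡ , eq₃ ← Fin.combine-injective (idx (centre i) (leaf t) _) _ _ _ eq₂
      with side-i , side-j ← Fin.combine-injective (side (place (leaf t)) _) _ _ _ eq₃
      with interleave-same-side
             (place-≢ (t≢t′ ∘ Fin.↑ʳ-injective k t t′)) (place-≢ (i≢j ∘ Fin.↑ˡ-injective N i j))
             (place-centre≢leaf i t) (place-centre≢leaf i t′)
             (place-centre≢leaf j t) (place-centre≢leaf j t′)
             side-i side-j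
    ... | inj₁ I = no-crossing (idx-page _ _ _ _ _ idx≡) same′ I
    ... | inj₂ I = no-crossing (≡.sym (idx-page _ _ _ _ _ idx≡)) same I

theorem3 : ∀ (k : ℕ) → 1 ≤ k →
    Σ ℕ λ n → Σ (Graph n) λ G → Treewidth≡ G k ×
    Σ ℕ λ pu → Σ ℕ λ pl → UnionPageNumber≡ G pu × LocalPageNumber≡ G pl ×
    pl ≤ pu × k ≤ pl
theorem3 k@(suc k₀) 1≤k =
  k + N , K k N , K-treewidth k N (s≤s z≤n) k≤N , k , k ,
  (book⇒union (K k N) (K-book k₀ N) , union-minimal) ,
  (book⇒local (K k N) (K-book k₀ N) , local-minimal) ,
  ≤-refl , ≤-refl
  where
  N : ℕ
  -- One more than the number of keys for `c = k`, so that a single graph defeats every `c < k`.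
  N = suc (k * (k * (k * 4)))

  k≤N : k ≤ N
  k≤N = m≤n⇒m≤1+n (m≤m*n k (k * (k * 4)))

  N-large : ∀ {c} → c < k → k * (k * (c * 4)) < N
  N-large c<k = s≤s (*-monoʳ-≤ k (*-monoʳ-≤ k (*-monoˡ-≤ 4 (<⇒≤ c<k))))

  union-minimal : ∀ p → HasUnionEmb (K k N) p → k ≤ p
  union-minimal p (O , π , union) = ≮⇒≥ λ p<k →
    K-¬union p<k (N-large p<k) O π (pages⇒pagesPerVertex (K k N) π) union

  local-minimal : ∀ p → HasLocalBook (K k N) p → k ≤ p
  local-minimal p (O , π , book , local) = ≮⇒≥ λ p<k →
    K-¬union p<k (N-large p<k) O π (local⇒pagesPerVertex (K k N) π local)
      -- A book embedding has no crossing within a page, hence none within a component.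
      λ u v x y e e′ eq _ → book u v x y e e′ eq
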